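{- For a pattern $\alpha$ let $H_\alpha(x)=\sum_{n\ge0}p_n(1213,\alpha)x^n$. Let $\rho=1(\tau+1)$ be a pattern of size at least two, where $\tau$ is a partition whose rightmost letter is greater than $1$. Then \[H_\rho(x)=1+\frac{x}{1-x}H_\tau(x)+\frac{x^2}{(1-x)(1-2x)}\bigl(H_\tau(x)-1\bigr).\] Consequently, if $p_n(1213,\tau)=p_n(1213,\tau')$ for all $n$ (with $\tau,\tau'$ both satisfying the hypothesis), then $p_n(1213,1(\tau+1))=p_n(1213,1(\tau'+1))$ for all $n$.
   Context: Set partitions of $[n]$ are written in canonical sequential form (restricted growth words). Pattern containment means having a subsequence order-isomorphic to the pattern; $p_n(T)$ is the number of partitions of $[n]$ avoiding every pattern in $T$. $\tau+1$ adds $1$ to every letter of $\tau$. -}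

module Defs where

open import Data.Fin.Base using (Fin; toℕ; cast)
open import Data.Fin.Properties using (all?)
open import Data.Integer.Base as ℤ using (ℤ; +_; 0ℤ; 1ℤ)
import Data.Integer.Properties as ℤₚ
open import Data.List.Base
  using (List; []; _∷_; length; lookup; map; concatMap; filter; upTo; last)
open import Data.List.Membership.Propositional using (_∈_; lose; find)
open import Data.List.Membership.Propositional.Properties
  using (∈-map⁺; ∈-map⁻; ∈-upTo⁺; ∈-upTo⁻; ∈-concatMap⁺; ∈-concatMap⁻)
open import Data.List.Properties using (∷-injectiveˡ; ∷-injectiveʳ)
open import Data.List.Relation.Binary.Sublist.Propositional
  using (_⊆_; []; _∷_; _∷ʳ_)
open import Data.List.Relation.Unary.All as All using (All)
import Data.List.Relation.Unary.All.Properties as Allₚ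
import Data.List.Relation.Unary.AllPairs as AllPairs
import Data.List.Relation.Unary.AllPairs.Properties as AllPairsₚ
open import Data.List.Relation.Unary.Any using (here)
open import Data.List.Relation.Unary.Unique.Propositional using (Unique)
import Data.List.Relation.Unary.Unique.Propositional.Properties as Uniqueₚ
import Data.Maybe.Relation.Unary.Any as Maybe
open import Data.Nat.Base using (ℕ; zero; suc; _≤_; _<_; _⊔_; _∸_; s≤s; z≤n)
import Data.Nat.Properties as ℕₚ
open import Data.Product.Base using (Σ; ∃; _×_; _,_)
open import Data.Vec.Base as Vec using (Vec; []; _∷_; head)
open import Function.Base using (_∘_)
open import Function.Bundles using (_⇔_; mk⇔; Equivalence)
open import Relation.Binary.PropositionalEquality
  using (_≡_; _≗_; refl; sym; trans; cong; cong₂; module ≡-Reasoning)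
open import Relation.Nullary using (¬_; Dec; yes; no)
open import Relation.Nullary.Decidable
  using (True; map′; _×-dec_; _→-dec_; ¬?; _⊎-dec_)
open import Relation.Unary using (Decidable)
open import Data.Sum.Base using (_⊎_; inj₁; inj₂)
open import Algebra.Properties.Monoid.Sum ℤₚ.+-0-monoid using (sum)

------------------------------------------------------------------------
-- Set partitions in canonical sequential form

Word : Set
Word = List ℕ

-- RGW m w: w may follow a prefix whose largest letter is m (m = 0 for
-- the empty prefix), every letter being positive and at most one more
-- than the maximum of everything before it.
data RGW (m : ℕ) : Word → Set where
  []  : RGW m []
  _∷_ : ∀ {a w} → 1 ≤ a × a ≤ suc m → RGW (m ⊔ a) w → RGW m (a ∷ w)

IsPartition : Word → Set
IsPartition = RGW 0

continuations : ℕ → ℕ → List Word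
continuations m zero    = [] ∷ []
continuations m (suc n) =
  concatMap (λ a → map (a ∷_) (continuations (m ⊔ a) n)) (map suc (upTo (suc m)))

-- All partitions of [n], each listed once; see ∈-partitions and
-- partitions-unique.
partitions : ℕ → List Word
partitions = continuations 0

∈-continuations⁺ : ∀ {m w} → RGW m w → w ∈ continuations m (length w)
∈-continuations⁺ [] = here refl
∈-continuations⁺ {m} {suc i ∷ w} ((s≤s z≤n , s≤s i≤m) ∷ r) =
  ∈-concatMap⁺ (λ a → map (a ∷_) (continuations (m ⊔ a) (length w)))
    (lose (∈-map⁺ suc (∈-upTo⁺ (s≤s i≤m))) (∈-map⁺ _ (∈-continuations⁺ r)))

∈-continuations⁻ : ∀ {m} n {w} → w ∈ continuations m n → length w ≡ n × RGW m w
∈-continuations⁻ zero (here refl) = refl , []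
∈-continuations⁻ {m} (suc n) w∈
  with find (∈-concatMap⁻ (λ a → map (a ∷_) (continuations (m ⊔ a) n))
                         {xs = map suc (upTo (suc m))} w∈)
... | a , a∈ , w∈a with ∈-map⁻ suc a∈ | ∈-map⁻ (a ∷_) w∈a
... | i , i∈ , refl | v , v∈ , refl with ∈-continuations⁻ n v∈
... | refl , r = refl , (s≤s z≤n , ∈-upTo⁻ i∈) ∷ r

∈-partitions : ∀ {n w} → w ∈ partitions n ⇔ (length w ≡ n × IsPartition w)
∈-partitions {n} = mk⇔ (∈-continuations⁻ n) λ where (refl , r) → ∈-continuations⁺ r

continuations-unique : ∀ m n → Unique (continuations m n)
continuations-unique m zero    = All.[] AllPairs.∷ AllPairs.[]
continuations-unique m (suc n) = Uniqueₚ.concat⁺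
  (Allₚ.map⁺ (All.universal
    (λ a → Uniqueₚ.map⁺ ∷-injectiveʳ (continuations-unique (m ⊔ a) n)) _))
  (AllPairsₚ.map⁺ (AllPairs.map disjoint
    (Uniqueₚ.map⁺ ℕₚ.suc-injective (Uniqueₚ.upTo⁺ (suc m)))))
  where
  disjoint : ∀ {a b} → ¬ a ≡ b → ∀ {w} →
             ¬ (w ∈ map (a ∷_) (continuations (m ⊔ a) n) ×
                w ∈ map (b ∷_) (continuations (m ⊔ b) n))
  disjoint {a} {b} a≢b (w∈a , w∈b) with ∈-map⁻ (a ∷_) w∈a | ∈-map⁻ (b ∷_) w∈b
  ... | _ , _ , refl | _ , _ , eq = a≢b (∷-injectiveˡ eq)

partitions-unique : ∀ n → Unique (partitions n)
partitions-unique = continuations-unique 0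

------------------------------------------------------------------------
-- Pattern containment

OrderIsomorphic : Word → Word → Set
OrderIsomorphic u v = Σ (length u ≡ length v) λ eq →
  ∀ i j → lookup u i < lookup u j ⇔ lookup v (cast eq i) < lookup v (cast eq j)

Contains : Word → Word → Set
Contains w τ = ∃ λ s → s ⊆ w × OrderIsomorphic s τ

AvoidsAll : List Word → Word → Set
AvoidsAll T w = All (λ τ → ¬ Contains w τ) T

orderIsomorphic? : ∀ u v → Dec (OrderIsomorphic u v)
orderIsomorphic? u v with length u ℕₚ.≟ length v
... | no  ¬eq = no λ (eq , _) → ¬eq eq
... | yes eq  = map′ (eq ,_) (λ (_ , iso) → iso)
  (all? λ i → all? λ j →
    (lookup u i ℕₚ.<? lookup u j)
      ⇔-dec (lookup v (cast eq i) ℕₚ.<? lookup v (cast eq j)))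
  where
  _⇔-dec_ : ∀ {A B : Set} → Dec A → Dec B → Dec (A ⇔ B)
  a? ⇔-dec b? = map′ (λ (f , g) → mk⇔ f g)
    (λ e → Equivalence.to e , Equivalence.from e) ((a? →-dec b?) ×-dec (b? →-dec a?))

anySublist? : ∀ {P : Word → Set} → Decidable P → ∀ w → Dec (∃ λ s → s ⊆ w × P s)
anySublist? P? [] = map′ (λ p → [] , [] , p) (λ where ([] , [] , p) → p) (P? [])
anySublist? {P} P? (a ∷ w) =
  map′ to from (anySublist? P? w ⊎-dec anySublist? (P? ∘ (a ∷_)) w)
  where
  to : (∃ λ s → s ⊆ w × P s) ⊎ (∃ λ s → s ⊆ w × P (a ∷ s)) → ∃ λ s → s ⊆ a ∷ w × P s
  to (inj₁ (s , s⊆w , p)) = s , a ∷ʳ s⊆w , p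
  to (inj₂ (s , s⊆w , p)) = a ∷ s , refl ∷ s⊆w , p
  from : (∃ λ s → s ⊆ a ∷ w × P s) → (∃ λ s → s ⊆ w × P s) ⊎ (∃ λ s → s ⊆ w × P (a ∷ s))
  from (s , _ ∷ʳ s⊆w , p)       = inj₁ (s , s⊆w , p)
  from (a ∷ s , refl ∷ s⊆w , p) = inj₂ (s , s⊆w , p)

contains? : ∀ w τ → Dec (Contains w τ)
contains? w τ = anySublist? (λ s → orderIsomorphic? s τ) w

avoidsAll? : ∀ T w → Dec (AvoidsAll T w)
avoidsAll? T w = All.all? (λ τ → ¬? (contains? w τ)) T

-- p T n is p_n(T).
p : List Word → ℕ → ℕ
p T n = length (filter (avoidsAll? T) (partitions n))

1213ₚ : Word
1213ₚ = 1 ∷ 2 ∷ 1 ∷ 3 ∷ []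

-- The word 1(τ+1).
1⟨_+1⟩ : Word → Word
1⟨ τ +1⟩ = 1 ∷ map suc τ

record Admissible (τ : Word) : Set where
  field
    isPartition : IsPartition τ
    last>1      : Maybe.Any (1 <_) (last τ)
    size≥2      : 2 ≤ length 1⟨ τ +1⟩

------------------------------------------------------------------------
-- Formal power series over ℤ, as coefficient sequences

Series : Set
Series = ℕ → ℤ

infixl 6 _+_ _-_
infixl 7 _*_ _/_

const : ℤ → Series
const c zero    = c
const c (suc n) = 0ℤ

x : Series
x 1 = 1ℤ
x _ = 0ℤ

_+_ _-_ _*_ : Series → Series → Series
(f + g) n = f n ℤ.+ g n
(f - g) n = f n ℤ.- g n
(f * g) n = sum {suc n} λ i → f (toℕ i) ℤ.* g (n ∸ toℕ i)

dot : ∀ {n} → Series → Vec ℤ n → ℤ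
dot {n} f v = sum {n} λ i → f (toℕ i) ℤ.* Vec.lookup v i

-- For g with constant term 1, the coefficients of 1/g in degrees
-- n, …, 1, 0, from (1/g)ₙ₊₁ = - Σ_{i ≤ n} gᵢ₊₁ (1/g)ₙ₋ᵢ.
recipCoeffs : Series → ∀ n → Vec ℤ (suc n)
recipCoeffs g zero    = 1ℤ ∷ []
recipCoeffs g (suc n) = ℤ.- dot (g ∘ suc) (recipCoeffs g n) ∷ recipCoeffs g n

recip : Series → Series
recip g n = head (recipCoeffs g n)

_/_ : Series → (g : Series) → {True (g 0 ℤₚ.≟ 1ℤ)} → Series
f / g = f * recip g

*-recip : ∀ g → g 0 ≡ 1ℤ → g * recip g ≗ const 1ℤ
*-recip g g₀≡1 zero    rewrite g₀≡1 = refl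
*-recip g g₀≡1 (suc n) = begin
  g 0 ℤ.* (ℤ.- dot (g ∘ suc) (recipCoeffs g n)) ℤ.+ (g ∘ suc * recip g) n
    ≡⟨ cong₂ ℤ._+_ (trans (cong (ℤ._* (ℤ.- d)) g₀≡1) (ℤₚ.*-identityˡ (ℤ.- d)))
                   (sym (dot-recip (g ∘ suc) n)) ⟩
  ℤ.- d ℤ.+ d  ≡⟨ ℤₚ.+-inverseˡ d ⟩
  0ℤ           ∎
  where
  open ≡-Reasoning
  d : ℤ
  d = dot (g ∘ suc) (recipCoeffs g n)
  dot-recip : ∀ f n → dot f (recipCoeffs g n) ≡ (f * recip g) n
  dot-recip f zero    = refl
  dot-recip f (suc n) = cong (ℤ._+_ (f 0 ℤ.* recip g (suc n))) (dot-recip (f ∘ suc) n)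

H : Word → Series
H α n = + p (1213ₚ ∷ α ∷ []) n

{-# OPTIONS --safe #-}

-- After 121 no letter of a partition avoiding 1213 exceeds 2.  Hence a nonempty
-- partition avoiding 1213 and ρ = 1(τ+1) is 1ᵏ, 1ᵏ(v+1) or 1ᵏ(v+1)1u, where k ≥ 1,
-- v is a nonempty partition avoiding 1213 and τ, and u is a word in 1 and 2.
-- Conversely u creates no forbidden pattern: the last letter of 1213 and of ρ
-- exceeds two distinct smaller letters of the pattern, so it cannot be played
-- by a letter ≤ 2.  Reading u from the right and 1ᵏ from the left turns this
-- decomposition into a linear system for the generating functions.

module Submission where

open import Algebra.Bundles using (CommutativeRing)
open import Algebra.Consequences.Setoid using (comm∧idˡ⇒id; comm∧distrʳ⇒distr)
import Algebra.Construct.Pointwise as Pointwise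
import Algebra.Properties.Group as GroupProperties
import Algebra.Solver.Ring.NaturalCoefficients.Default as SemiringSolver
open import Algebra.Structures using (IsAbelianGroup)
open import Data.Empty using (⊥-elim)
open import Data.Fin.Base using (zero; suc; cast)
open import Data.Fin.Properties using (cast-involutive; cast-trans)
open import Data.Integer.Base as ℤ using (ℤ; +_; 0ℤ; 1ℤ)
import Data.Integer.Properties as ℤ
open import Data.Integer.Solver using (module +-*-Solver)
open import Data.List.Base as List
  using (List; []; _∷_; _++_; length; lookup; map; filter; last)
open import Data.List.Membership.Propositional using (_∈_)
open import Data.List.Membership.Propositional.Properties
  using (∈-map⁺; ∈-map⁻; ∈-++⁺ˡ; ∈-++⁺ʳ; ∈-++⁻; ∈-filter⁺; ∈-filter⁻; ∈-lookup)
open import Data.List.Membership.Propositional.Properties.WithK using (unique∧set⇒bag)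
open import Data.List.Properties
  using (length-map; length-++; ∷-injectiveʳ; ∷ʳ-injective; ∷ʳ-++; ++-identityʳ;
         map-injective; last-map)
open import Data.List.Relation.Binary.BagAndSetEquality using (∼bag⇒↭)
open import Data.List.Relation.Binary.Disjoint.Propositional using (Disjoint)
open import Data.List.Relation.Binary.Permutation.Propositional.Properties using (↭-length)
open import Data.List.Relation.Binary.Sublist.Propositional
  using (_⊆_; []; _∷_; _∷ʳ_; minimum; ⊆-refl; ⊆-trans; from∈)
import Data.List.Relation.Binary.Sublist.Propositional.Properties as Sublist
open import Data.List.Relation.Unary.All as All using (All; []; _∷_)
import Data.List.Relation.Unary.All.Properties as All
open import Data.List.Relation.Unary.AllPairs using ([]; _∷_)
open import Data.List.Relation.Unary.Any using (here)
open import Data.List.Relation.Unary.Unique.Propositional using (Unique)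
import Data.List.Relation.Unary.Unique.Propositional.Properties as Unique
open import Data.Maybe.Base using () renaming (map to mapMaybe)
open import Data.Maybe.Relation.Unary.Any as Maybe using (just)
open import Data.Nat.Base as ℕ using (ℕ; zero; suc; _≤_; _<_; _∸_; z≤n; s≤s)
import Data.Nat.Properties as ℕ
open import Data.Product.Base using (∃; _×_; _,_; proj₁; proj₂)
open import Data.Sum.Base using (inj₁; inj₂)
open import Defs hiding (_+_; _-_; _*_; x)
open import Function.Base using (_∘_)
open import Function.Bundles using (_⇔_; mk⇔; Equivalence)
import Function.Properties.Equivalence as ⇔
open import Level using (0ℓ)
open import Relation.Binary.Definitions using (tri<; tri≈; tri>)
open import Relation.Binary.PropositionalEquality
  using (_≡_; _≗_; refl; sym; trans; cong; cong₂; subst; subst₂; module ≡-Reasoning)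
import Relation.Binary.Reasoning.Setoid as ≈-Reasoning
open import Relation.Nullary using (¬_; contradiction)

-- Linear algebra

module LinearSystem {c ℓ} (R : CommutativeRing c ℓ) where
  open CommutativeRing R renaming (refl to ≈-refl; trans to ≈-trans)
  open GroupProperties +-group using (//-rightDividesˡ; //-rightDividesʳ)
    renaming (∙-cancelʳ to +-cancelʳ)
  open SemiringSolver commutativeSemiring
  open ≈-Reasoning setoid

  geometric : ∀ {d t f} → f ≈ t + d * f → (1# - d) * f ≈ t
  geometric {d} {t} {f} f≈ = +-cancelʳ (d * f) ((1# - d) * f) t (begin
    (1# - d) * f + d * f  ≈⟨ distribʳ f (1# - d) d ⟨
    (1# - d + d) * f      ≈⟨ *-congʳ (//-rightDividesˡ d 1#) ⟩
    1# * f                ≈⟨ *-identityˡ f ⟩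
    f                     ≈⟨ f≈ ⟩
    t + d * f             ∎)

  cancel : ∀ {u s} f → u * s ≈ 1# → f ≈ s * (u * f)
  cancel {u} {s} f us≈1 = begin
    f            ≈⟨ *-identityˡ f ⟨
    1# * f       ≈⟨ *-congʳ us≈1 ⟨
    u * s * f    ≈⟨ solve 3 (λ u s f → u :* s :* f := s :* (u :* f)) ≈-refl u s f ⟩
    s * (u * f)  ∎

  -- Here `h` will be `H τ`, while `g`, `m` and `f` will count `cores`, `mixed` and `full` by
  -- length, and `y` will be 2x. The equation for `m` is solved first and then the one for `f`, with
  -- `s` and `r` in the role of 1/(1-x) and 1/((1-x)(1-y)).
  system-solution : ∀ {x y s r f g m h} →
    (1# - x) * s ≈ 1# → ((1# - x) * (1# - y)) * r ≈ 1# →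
    h ≈ g + 1# → m ≈ x * g + y * m → f ≈ 1# + x * (g + m) + x * f →
    f ≈ 1# + x * s * h + x * x * r * (h - 1#)
  system-solution {x} {y} {s} {r} {f} {g} {m} {h} us≈1 uvr≈1 h≈ m≈ f≈ = begin
    f
      ≈⟨ cancel f us≈1 ⟩
    s * (u * f)
      ≈⟨ *-congˡ (geometric f≈) ⟩
    s * (1# + x * (g + m))
      -- Writing 1 as (1-x) + x turns its product with `s` into 1 + xs, and xs then joins xsg to
      -- form xsh.
      ≈⟨ *-congˡ (+-cong 1≈u+x (*-congˡ (+-congˡ m≈′))) ⟩
    s * ((u + x * 1#) + x * (g + r * (u * (x * g))))
      ≈⟨ solve 6 (λ s u x o g r → s :* ((u :+ x :* o) :+ x :* (g :+ r :* (u :* (x :* g))))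
                := u :* s :+ x :* s :* (g :+ o) :+ x :* x :* r :* g :* (u :* s))
           ≈-refl s u x 1# g r ⟩
    u * s + x * s * (g + 1#) + x * x * r * g * (u * s)
      ≈⟨ +-cong (+-congʳ us≈1) (≈-trans (*-congˡ us≈1) (*-identityʳ _)) ⟩
    1# + x * s * (g + 1#) + x * x * r * g
      ≈⟨ +-cong (+-congˡ (*-congˡ h≈)) (*-congˡ h-1≈g) ⟨
    1# + x * s * h + x * x * r * (h - 1#) ∎
    where
    u = 1# - x
    v = 1# - y
    -- Only the product (1-x)(1-y) has a given inverse, so 1/(1-y) appears as r(1-x); the extra
    -- factor 1-x later cancels against `s`.
    m≈′ : m ≈ r * (u * (x * g))
    m≈′ = begin
      m                  ≈⟨ cancel m uvr≈1 ⟩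
      r * (u * v * m)    ≈⟨ *-congˡ (*-assoc u v m) ⟩
      r * (u * (v * m))  ≈⟨ *-congˡ (*-congˡ (geometric m≈)) ⟩
      r * (u * (x * g))  ∎
    1≈u+x : 1# ≈ u + x * 1#
    1≈u+x = begin
      1#          ≈⟨ //-rightDividesˡ x 1# ⟨
      u + x       ≈⟨ +-congˡ (*-identityʳ x) ⟨
      u + x * 1#  ∎
    h-1≈g : h - 1# ≈ g
    h-1≈g = begin
      h - 1#       ≈⟨ +-congʳ h≈ ⟩
      g + 1# - 1#  ≈⟨ //-rightDividesʳ 1# g ⟩
      g            ∎

open Defs using (_+_; _-_; _*_; x)

-- The ring of formal power series

+-interchange : ∀ a b c d → (a ℤ.+ b) ℤ.+ (c ℤ.+ d) ≡ (a ℤ.+ c) ℤ.+ (b ℤ.+ d)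
+-interchange = solve 4 (λ a b c d → (a :+ b) :+ (c :+ d) := (a :+ c) :+ (b :+ d)) refl
  where open +-*-Solver

-- In degree n+1 the product computes to `f 0 ℤ.* g (suc n) ℤ.+ (f ∘ suc * g) n`. This law and
-- several below are therefore proved by induction on the degree with the left factor varying.
*-cong : ∀ {f f′ g g′ : Series} → f ≗ f′ → g ≗ g′ → f * g ≗ f′ * g′
*-cong f≗ g≗ zero    = cong (ℤ._+ 0ℤ) (cong₂ ℤ._*_ (f≗ 0) (g≗ 0))
*-cong f≗ g≗ (suc n) =
  cong₂ ℤ._+_ (cong₂ ℤ._*_ (f≗ 0) (g≗ (suc n))) (*-cong (f≗ ∘ suc) g≗ n)

*-distribʳ-+ : ∀ (h f g : Series) → (f + g) * h ≗ f * h + g * h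
*-distribʳ-+ h f g zero    = begin
  (f 0 ℤ.+ g 0) ℤ.* h 0 ℤ.+ 0ℤ
    ≡⟨ cong (ℤ._+ 0ℤ) (ℤ.*-distribʳ-+ (h 0) (f 0) (g 0)) ⟩
  (f 0 ℤ.* h 0 ℤ.+ g 0 ℤ.* h 0) ℤ.+ (0ℤ ℤ.+ 0ℤ)
    ≡⟨ +-interchange (f 0 ℤ.* h 0) (g 0 ℤ.* h 0) 0ℤ 0ℤ ⟩
  (f 0 ℤ.* h 0 ℤ.+ 0ℤ) ℤ.+ (g 0 ℤ.* h 0 ℤ.+ 0ℤ) ∎
  where open ≡-Reasoning
*-distribʳ-+ h f g (suc n) = trans
  (cong₂ ℤ._+_ (ℤ.*-distribʳ-+ (h (suc n)) (f 0) (g 0))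
               (*-distribʳ-+ h (f ∘ suc) (g ∘ suc) n))
  (+-interchange (f 0 ℤ.* h (suc n)) (g 0 ℤ.* h (suc n))
                 ((f ∘ suc * h) n) ((g ∘ suc * h) n))

*-scaleˡ : ∀ c (f g : Series) n → ((λ k → c ℤ.* f k) * g) n ≡ c ℤ.* (f * g) n
*-scaleˡ c f g zero    =
  solve 3 (λ a b d → a :* b :* d :+ con 0ℤ := a :* (b :* d :+ con 0ℤ)) refl c (f 0) (g 0)
  where open +-*-Solver
*-scaleˡ c f g (suc n) = trans
  (cong₂ ℤ._+_ (ℤ.*-assoc c (f 0) (g (suc n))) (*-scaleˡ c (f ∘ suc) g n))
  (sym (ℤ.*-distribˡ-+ c (f 0 ℤ.* g (suc n)) ((f ∘ suc * g) n)))

*-assoc : ∀ (f g h : Series) → (f * g) * h ≗ f * (g * h)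
*-assoc f g h zero    =
  solve 3 (λ a b c → (a :* b :+ con 0ℤ) :* c :+ con 0ℤ := a :* (b :* c :+ con 0ℤ) :+ con 0ℤ)
    refl (f 0) (g 0) (h 0)
  where open +-*-Solver
*-assoc f g h (suc n) = begin
  (f 0 ℤ.* g 0 ℤ.+ 0ℤ) ℤ.* h (suc n)
    ℤ.+ (((λ k → f 0 ℤ.* g (suc k)) + f ∘ suc * g) * h) n
    -- The shift of `f * g` is `f 0` times `g ∘ suc` plus `f ∘ suc * g`, which isolates the smaller
    -- instance.
    ≡⟨ cong₂ ℤ._+_ (refl {x = (f 0 ℤ.* g 0 ℤ.+ 0ℤ) ℤ.* h (suc n)})
         (trans (*-distribʳ-+ h (λ k → f 0 ℤ.* g (suc k)) (f ∘ suc * g) n)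
                (cong₂ ℤ._+_ (*-scaleˡ (f 0) (g ∘ suc) h n) (*-assoc (f ∘ suc) g h n))) ⟩
  (f 0 ℤ.* g 0 ℤ.+ 0ℤ) ℤ.* h (suc n)
    ℤ.+ (f 0 ℤ.* (g ∘ suc * h) n ℤ.+ (f ∘ suc * (g * h)) n)
    ≡⟨ solve 5 (λ a b c d e → (a :* b :+ con 0ℤ) :* c :+ (a :* d :+ e)
                            := a :* (b :* c :+ d) :+ e)
         refl (f 0) (g 0) (h (suc n)) ((g ∘ suc * h) n) ((f ∘ suc * (g * h)) n) ⟩
  f 0 ℤ.* (g 0 ℤ.* h (suc n) ℤ.+ (g ∘ suc * h) n) ℤ.+ (f ∘ suc * (g * h)) n ∎
  where
  open ≡-Reasoning
  open +-*-Solver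

-- Products unfold from the first summand; splitting off the last one instead lets `*-comm` match
-- the two orders of summation.
*-suc-last : ∀ (f g : Series) n → (f * g) (suc n) ≡ f (suc n) ℤ.* g 0 ℤ.+ (f * g ∘ suc) n
*-suc-last f g zero    =
  solve 2 (λ a b → a :+ (b :+ con 0ℤ) := b :+ (a :+ con 0ℤ)) refl (f 0 ℤ.* g 1) (f 1 ℤ.* g 0)
  where open +-*-Solver
*-suc-last f g (suc n) = trans
  (cong₂ ℤ._+_ (refl {x = f 0 ℤ.* g (suc (suc n))}) (*-suc-last (f ∘ suc) g n))
  (solve 3 (λ a b c → a :+ (b :+ c) := b :+ (a :+ c)) refl
    (f 0 ℤ.* g (suc (suc n))) (f (suc (suc n)) ℤ.* g 0) ((f ∘ suc * g ∘ suc) n))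
  where open +-*-Solver

*-comm : ∀ (f g : Series) → f * g ≗ g * f
*-comm f g zero    = cong (ℤ._+ 0ℤ) (ℤ.*-comm (f 0) (g 0))
*-comm f g (suc n) = trans (*-suc-last f g n)
  (cong₂ ℤ._+_ (ℤ.*-comm (f (suc n)) (g 0)) (*-comm f (g ∘ suc) n))

*-zeroˡ : ∀ (f : Series) → (λ _ → 0ℤ) * f ≗ (λ _ → 0ℤ)
*-zeroˡ f zero    = refl
*-zeroˡ f (suc n) = trans (ℤ.+-identityˡ _) (*-zeroˡ f n)

const-* : ∀ c (f : Series) n → (const c * f) n ≡ c ℤ.* f n
const-* c f zero    = ℤ.+-identityʳ (c ℤ.* f 0)
const-* c f (suc n) =
  trans (cong₂ ℤ._+_ (refl {x = c ℤ.* f (suc n)}) (*-zeroˡ f n)) (ℤ.+-identityʳ (c ℤ.* f (suc n)))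

x-*-suc : ∀ (f : Series) n → (x * f) (suc n) ≡ f n
x-*-suc f n = begin
  0ℤ ℤ.+ (x ∘ suc * f) n  ≡⟨ ℤ.+-identityˡ ((x ∘ suc * f) n) ⟩
  (x ∘ suc * f) n         ≡⟨ *-cong {g = f} x∘suc (λ _ → refl) n ⟩
  (const 1ℤ * f) n        ≡⟨ const-* 1ℤ f n ⟩
  1ℤ ℤ.* f n              ≡⟨ ℤ.*-identityˡ (f n) ⟩
  f n                     ∎
  where
  open ≡-Reasoning
  x∘suc : x ∘ suc ≗ const 1ℤ
  x∘suc zero    = refl
  x∘suc (suc n) = refl

seriesRing : CommutativeRing 0ℓ 0ℓ
seriesRing = record
  { Carrier           = Series
  ; _≈_               = _≗_
  ; _+_               = _+_
  ; _*_               = _*_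
  ; -_                = ℤ.-_ ∘_
  ; 0#                = λ _ → 0ℤ
  ; 1#                = const 1ℤ
  ; isCommutativeRing = record
    { isRing = record
      { +-isAbelianGroup = +-isAbelianGroup
      ; *-cong           = *-cong
      ; *-assoc          = *-assoc
      ; *-identity       = comm∧idˡ⇒id setoid *-comm *-identityˡ
      ; distrib          = comm∧distrʳ⇒distr setoid ∙-cong *-comm *-distribʳ-+
      }
    ; *-comm = *-comm
    }
  }
  where
  +-isAbelianGroup : IsAbelianGroup _≗_ _+_ (λ _ → 0ℤ) (ℤ.-_ ∘_)
  +-isAbelianGroup = Pointwise.isAbelianGroup ℕ ℤ.+-0-isAbelianGroup
  open IsAbelianGroup +-isAbelianGroup using (setoid; ∙-cong)
  *-identityˡ : ∀ f → const 1ℤ * f ≗ f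
  *-identityˡ f n = trans (const-* 1ℤ f n) (ℤ.*-identityˡ (f n))

-- Order isomorphism and pattern containment

OrderIsomorphic-sym : ∀ u v → OrderIsomorphic u v → OrderIsomorphic v u
OrderIsomorphic-sym u v (eq , iso) = sym eq , λ i j → ⇔.sym
  (subst₂ (λ k l → lookup u (cast (sym eq) i) < lookup u (cast (sym eq) j)
                   ⇔ lookup v k < lookup v l)
    (cast-involutive eq (sym eq) i) (cast-involutive eq (sym eq) j)
    (iso (cast (sym eq) i) (cast (sym eq) j)))

OrderIsomorphic-trans : ∀ u v w →
  OrderIsomorphic u v → OrderIsomorphic v w → OrderIsomorphic u w
OrderIsomorphic-trans u v w (eq , iso) (eq′ , iso′) = trans eq eq′ , λ i j →
  subst₂ (λ k l → lookup u i < lookup u j ⇔ lookup w k < lookup w l)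
    (cast-trans eq eq′ i) (cast-trans eq eq′ j)
    (⇔.trans (iso i j) (iso′ (cast eq i) (cast eq j)))

StrictlyMonotone : (ℕ → ℕ) → Set
StrictlyMonotone f = ∀ {a b} → a < b → f a < f b

lookup-map : ∀ (f : ℕ → ℕ) u .(eq : length u ≡ length (map f u)) i →
             lookup (map f u) (cast eq i) ≡ f (lookup u i)
lookup-map f (a ∷ u) eq zero    = refl
lookup-map f (a ∷ u) eq (suc i) = lookup-map f u (ℕ.suc-injective eq) i

map-OrderIsomorphic : ∀ {f} → StrictlyMonotone f → ∀ u → OrderIsomorphic u (map f u)
map-OrderIsomorphic {f} mono u = eq , λ i j →
  subst₂ (λ a b → lookup u i < lookup u j ⇔ a < b)
    (sym (lookup-map f u eq i)) (sym (lookup-map f u eq j)) (mk⇔ mono reflects)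
  where
  eq : length u ≡ length (map f u)
  eq = sym (length-map f u)
  reflects : ∀ {a b} → f a < f b → a < b
  reflects {a} {b} fa<fb with ℕ.<-cmp a b
  ... | tri< a<b _ _  = a<b
  ... | tri≈ _ refl _ = contradiction fa<fb (ℕ.<-irrefl refl)
  ... | tri> _ _ b<a  = contradiction fa<fb (ℕ.<-asym (mono b<a))

OrderIsomorphic-tail : ∀ {a b u v} →
  OrderIsomorphic (a ∷ u) (b ∷ v) → OrderIsomorphic u v
OrderIsomorphic-tail (eq , iso) = ℕ.suc-injective eq , λ i j → iso (suc i) (suc j)

∷-OrderIsomorphic : ∀ {a b u v} → All (a <_) u → All (b <_) v →
  OrderIsomorphic u v → OrderIsomorphic (a ∷ u) (b ∷ v)
∷-OrderIsomorphic {a} {b} {u} {v} a<u b<v (eq , iso) = cong suc eq , λ where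
    zero    zero    → mk⇔ (⊥-elim ∘ ℕ.<-irrefl refl) (⊥-elim ∘ ℕ.<-irrefl refl)
    zero    (suc j) → mk⇔ (λ _ → b<v! j) (λ _ → a<u! j)
    (suc i) zero    → mk⇔ (⊥-elim ∘ ℕ.<-asym (a<u! i)) (⊥-elim ∘ ℕ.<-asym (b<v! i))
    (suc i) (suc j) → iso i j
  where
  a<u! : ∀ i → a < lookup u i
  a<u! i = All.lookup a<u (∈-lookup i)
  b<v! : ∀ i → b < lookup v (cast eq i)
  b<v! i = All.lookup b<v (∈-lookup (cast eq i))

-- Equal lengths make the last positions correspond. This carries a bound on the last letter of a
-- pattern over to its occurrences.
last-transfer : ∀ {P Q : ℕ → Set} u v (eq : length u ≡ length v) →
  (∀ i → P (lookup v (cast eq i)) → Q (lookup u i)) →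
  Maybe.Any P (last v) → Maybe.Any Q (last u)
last-transfer (a ∷ [])     (b ∷ [])     eq f (just p) = just (f zero p)
last-transfer (a ∷ c ∷ u) (b ∷ d ∷ v) eq f p =
  last-transfer (c ∷ u) (d ∷ v) (ℕ.suc-injective eq) (f ∘ suc) p

Contains-⊆ : ∀ {v w α} → v ⊆ w → Contains v α → Contains w α
Contains-⊆ v⊆w (s , s⊆v , iso) = s , ⊆-trans s⊆v v⊆w , iso

Contains-map⁺ : ∀ {f w α} → StrictlyMonotone f → Contains w α → Contains (map f w) α
Contains-map⁺ {f} {α = α} mono (s , s⊆w , iso) =
  map f s , Sublist.map⁺ f s⊆w ,
  OrderIsomorphic-trans (map f s) s α
    (OrderIsomorphic-sym s (map f s) (map-OrderIsomorphic mono s)) iso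

⊆-map⁻ : ∀ (f : ℕ → ℕ) {s} w → s ⊆ map f w → ∃ λ t → t ⊆ w × s ≡ map f t
⊆-map⁻ f []      []           = [] , [] , refl
⊆-map⁻ f (a ∷ w) (_ ∷ʳ s⊆)   with ⊆-map⁻ f w s⊆
... | t , t⊆w , refl = t , a ∷ʳ t⊆w , refl
⊆-map⁻ f (a ∷ w) (refl ∷ s⊆) with ⊆-map⁻ f w s⊆
... | t , t⊆w , refl = a ∷ t , refl ∷ t⊆w , refl

Contains-map⁻ : ∀ {f w α} → StrictlyMonotone f → Contains (map f w) α → Contains w α
Contains-map⁻ {f} {w} {α} mono (s , s⊆ , iso) with ⊆-map⁻ f w s⊆
... | t , t⊆w , refl = t , t⊆w , OrderIsomorphic-trans t (map f t) α (map-OrderIsomorphic mono t) iso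

suc-mono : StrictlyMonotone suc
suc-mono = s≤s

-- Both 1213 and 1(τ+1) are of this form.
data Tall : Word → Set where
  tall : ∀ {β} → Maybe.Any (2 <_) (last (1 ∷ 2 ∷ β)) → Tall (1 ∷ 2 ∷ β)

-- An embedding that used the final `c` would make it the last letter of `s`, which is greater than
-- `c`.
⊆-∷ʳ⁻ : ∀ {c s} w → Maybe.Any (c <_) (last s) → s ⊆ w List.∷ʳ c → s ⊆ w
⊆-∷ʳ⁻ []      (just c<c) (refl ∷ [])       = contradiction c<c (ℕ.<-irrefl refl)
⊆-∷ʳ⁻ []      ()         (_ ∷ʳ [])
⊆-∷ʳ⁻ (a ∷ w) c<last     (_ ∷ʳ s⊆)         = a ∷ʳ ⊆-∷ʳ⁻ w c<last s⊆
-- A one-letter `s` is treated apart, since its empty tail has no last letter to recurse with.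
⊆-∷ʳ⁻ {s = _ ∷ []}    (a ∷ w) c<last (refl ∷ s⊆) = refl ∷ minimum w
⊆-∷ʳ⁻ {s = _ ∷ _ ∷ _} (a ∷ w) c<last (refl ∷ s⊆) = refl ∷ ⊆-∷ʳ⁻ w c<last s⊆

Contains-∷ʳ⁻ : ∀ {α w c} → Tall α → All (1 ≤_) w → 1 ≤ c → c ≤ 2 →
  Contains (w List.∷ʳ c) α → Contains w α
Contains-∷ʳ⁻ {w = w} {c} (tall {β} 2<last) 1≤w 1≤c c≤2 (s , s⊆ , iso) =
  s , ⊆-∷ʳ⁻ w (Maybe.map (ℕ.≤-<-trans c≤2) (last>2 s 1≤s iso)) s⊆ , iso
  where
  1≤s : All (1 ≤_) s
  1≤s = Sublist.All-resp-⊆ s⊆ (All.∷ʳ⁺ 1≤w 1≤c)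
  last>2 : ∀ s → All (1 ≤_) s → OrderIsomorphic s (1 ∷ 2 ∷ β) → Maybe.Any (2 <_) (last s)
  last>2 (a ∷ b ∷ s) (1≤a ∷ _) (eq , iso) =
    last-transfer (a ∷ b ∷ s) (1 ∷ 2 ∷ β) eq
      (λ i 2<β → ℕ.≤-<-trans 2≤b (Equivalence.from (iso (suc zero) i) 2<β)) 2<last
    where
    2≤b : 2 ≤ b
    2≤b = ℕ.≤-trans (s≤s 1≤a) (Equivalence.from (iso zero (suc zero)) (s≤s (s≤s z≤n)))

-- The pattern starts with an ascent, so an occurrence uses at most one of the two equal initial
-- letters.
Contains-11⁻ : ∀ {α w} → Tall α → Contains (1 ∷ 1 ∷ w) α → Contains (1 ∷ w) α
Contains-11⁻ _ (s , _ ∷ʳ s⊆ , iso)                   = s , s⊆ , iso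
Contains-11⁻ _ (.1 ∷ s , refl ∷ (_ ∷ʳ s⊆) , iso)     = 1 ∷ s , refl ∷ s⊆ , iso
Contains-11⁻ (tall _) (.1 ∷ .1 ∷ s , refl ∷ (refl ∷ _) , (_ , iso)) =
  contradiction (Equivalence.from (iso zero (suc zero)) (s≤s (s≤s z≤n))) (ℕ.<-irrefl refl)

[1]-avoids : ∀ {α} → Tall α → ¬ Contains (1 ∷ []) α
[1]-avoids (tall _) (_ , _ ∷ʳ [] , () , _)
[1]-avoids (tall _) (_ , refl ∷ [] , () , _)

map-suc>1 : ∀ {v} → All (1 ≤_) v → All (1 <_) (map suc v)
map-suc>1 1≤v = All.map⁺ (All.map s≤s 1≤v)

-- The first letter of 1213 recurs in third place, but every letter after the leading 1 exceeds 1.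
-- Hence an occurrence lies in v+1.
Contains-1213-1⟨+1⟩⁻ : ∀ {v} → All (1 ≤_) v → Contains 1⟨ v +1⟩ 1213ₚ → Contains v 1213ₚ
Contains-1213-1⟨+1⟩⁻ 1≤v (s , _ ∷ʳ s⊆ , iso) = Contains-map⁻ suc-mono (s , s⊆ , iso)
Contains-1213-1⟨+1⟩⁻ 1≤v (.1 ∷ b ∷ c ∷ s , refl ∷ s⊆ , (_ , iso))
  with _ ∷ 1<c ∷ _ ← Sublist.All-resp-⊆ s⊆ (map-suc>1 1≤v) =
  contradiction (Equivalence.to (iso zero (suc (suc zero))) 1<c) (ℕ.<-irrefl refl)

-- Whether or not the occurrence starts at the leading 1, its remaining letters lie in v+1 and play
-- τ+1.
Contains-1⟨+1⟩⁻ : ∀ {v τ} → Contains 1⟨ v +1⟩ 1⟨ τ +1⟩ → Contains v τ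
Contains-1⟨+1⟩⁻ {v} {τ} (a ∷ s , as⊆ , iso) =
  Contains-map⁻ {α = τ} suc-mono
    (s , tail⊆ as⊆ , OrderIsomorphic-trans s (map suc τ) τ
       (OrderIsomorphic-tail {a} {1} {s} {map suc τ} iso)
       (OrderIsomorphic-sym τ (map suc τ) (map-OrderIsomorphic suc-mono τ)))
  where
  tail⊆ : ∀ {w} → a ∷ s ⊆ 1 ∷ w → s ⊆ w
  tail⊆ (_ ∷ʳ as⊆w) = Sublist.∷ˡ⁻ as⊆w
  tail⊆ (refl ∷ s⊆w) = s⊆w

-- A leading 1 is strictly below every raised letter, so prefixing it to occurrence and pattern
-- alike preserves the order isomorphism.
Contains-1⟨+1⟩⁺ : ∀ {v τ} → All (1 ≤_) v → All (1 ≤_) τ →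
  Contains v τ → Contains 1⟨ v +1⟩ 1⟨ τ +1⟩
Contains-1⟨+1⟩⁺ {v} {τ} 1≤v 1≤τ (s , s⊆v , iso) =
  1⟨ s +1⟩ , refl ∷ Sublist.map⁺ suc s⊆v ,
  ∷-OrderIsomorphic (map-suc>1 (Sublist.All-resp-⊆ s⊆v 1≤v)) (map-suc>1 1≤τ)
    (OrderIsomorphic-trans (map suc s) s (map suc τ)
      (OrderIsomorphic-sym s (map suc s) (map-OrderIsomorphic suc-mono s))
      (OrderIsomorphic-trans s τ (map suc τ) iso (map-OrderIsomorphic suc-mono τ)))

121c-Contains-1213 : ∀ {c} → 3 ≤ c → Contains (1 ∷ 2 ∷ 1 ∷ c ∷ []) 1213ₚ
121c-Contains-1213 (s≤s (s≤s (s≤s (z≤n {k})))) =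
  _ , ⊆-refl , OrderIsomorphic-sym 1213ₚ _
    -- `stretch 3` computes to `3 + (k + 0)`.
    (subst (λ c → OrderIsomorphic 1213ₚ (1 ∷ 2 ∷ 1 ∷ 3 ℕ.+ c ∷ [])) (ℕ.+-identityʳ k)
      (map-OrderIsomorphic mono 1213ₚ))
  where
  -- Fixes 1 and 2 and sends 3 to 3 + k.
  stretch : ℕ → ℕ
  stretch a = a ℕ.+ (a ∸ 2) ℕ.* k
  mono : StrictlyMonotone stretch
  mono a<b = ℕ.+-mono-<-≤ a<b (ℕ.*-monoˡ-≤ k (ℕ.∸-monoˡ-≤ 2 (ℕ.<⇒≤ a<b)))

-- Restricted growth words

RGW-positive : ∀ {m w} → RGW m w → All (1 ≤_) w
RGW-positive []              = []
RGW-positive ((1≤a , _) ∷ r) = 1≤a ∷ RGW-positive r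

RGW-suc⁺ : ∀ {m w} → RGW m w → RGW (suc m) (map suc w)
RGW-suc⁺ []                = []
RGW-suc⁺ ((1≤a , a≤) ∷ r) = (s≤s z≤n , s≤s a≤) ∷ RGW-suc⁺ r

RGW-suc⁻ : ∀ {m w} → All (1 ≤_) w → RGW (suc m) (map suc w) → RGW m w
RGW-suc⁻ []          []                  = []
RGW-suc⁻ (1≤a ∷ 1≤w) ((_ , s≤s a≤) ∷ r) = (1≤a , a≤) ∷ RGW-suc⁻ 1≤w r

-- The running maximum never falls below `m`, so the bound on `c` still holds at the end of the
-- word.
RGW-∷ʳ⁺ : ∀ {m w c} → 1 ≤ c → c ≤ suc m → RGW m w → RGW m (w List.∷ʳ c)
RGW-∷ʳ⁺ 1≤c c≤ []                    = (1≤c , c≤) ∷ []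
RGW-∷ʳ⁺ {m} {a ∷ _} 1≤c c≤ (a-ok ∷ r) =
  a-ok ∷ RGW-∷ʳ⁺ 1≤c (ℕ.≤-trans c≤ (s≤s (ℕ.m≤m⊔n m a))) r

RGW-++⁻ˡ : ∀ {m} v {u} → RGW m (v ++ u) → RGW m v
RGW-++⁻ˡ []      r          = []
RGW-++⁻ˡ (a ∷ v) (a-ok ∷ r) = a-ok ∷ RGW-++⁻ˡ v r

-- A view of a positive word cut at its first 1; the letters before the cut are at least 2, hence
-- raised positive letters.
data FirstOne : Word → Set where
  absent  : ∀ v   → All (1 ≤_) v → FirstOne (map suc v)
  present : ∀ v u → All (1 ≤_) v → FirstOne (map suc v ++ 1 ∷ u)

firstOne : ∀ {w} → All (1 ≤_) w → FirstOne w
firstOne []                                = absent [] []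
firstOne {suc zero ∷ w} (_ ∷ _)            = present [] w []
firstOne {suc (suc a) ∷ _} (_ ∷ 1≤w) with firstOne 1≤w
... | absent v 1≤v    = absent (suc a ∷ v) (s≤s z≤n ∷ 1≤v)
... | present v u 1≤v = present (suc a ∷ v) u (s≤s z≤n ∷ 1≤v)

-- Enumeration

unique∧set⇒length : ∀ {A : Set} {xs ys : List A} → Unique xs → Unique ys →
  (∀ {x} → x ∈ xs ⇔ x ∈ ys) → length xs ≡ length ys
unique∧set⇒length xs! ys! xs∼ys = ↭-length (∼bag⇒↭ (unique∧set⇒bag xs! ys! xs∼ys))

AvoidsAll-⊆ : ∀ {T v w} → v ⊆ w → AvoidsAll T w → AvoidsAll T v
AvoidsAll-⊆ v⊆w = All.map (λ {α} ¬c c → ¬c (Contains-⊆ {α = α} v⊆w c))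

avoiders : List Word → ℕ → List Word
avoiders T n = filter (avoidsAll? T) (partitions n)

∈-avoiders⁺ : ∀ {T w} → IsPartition w → AvoidsAll T w → w ∈ avoiders T (length w)
∈-avoiders⁺ {T} r = ∈-filter⁺ (avoidsAll? T) (Equivalence.from ∈-partitions (refl , r))

∈-avoiders⁻ : ∀ T n {w} → w ∈ avoiders T n → length w ≡ n × IsPartition w × AvoidsAll T w
∈-avoiders⁻ T n w∈ with ∈-filter⁻ (avoidsAll? T) {xs = partitions n} w∈
... | w∈ₚ , av with Equivalence.to ∈-partitions w∈ₚ
... | len , r = len , r , av

avoiders-unique : ∀ T n → Unique (avoiders T n)
avoiders-unique T n = Unique.filter⁺ (avoidsAll? T) (partitions-unique n)

-- Decomposition of the partitions avoiding 1213 and 1(τ+1)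

module Decomposition (τ : Word) (1≤τ : All (1 ≤_) τ)
  (1213-ρ-tall : All Tall (1213ₚ ∷ 1⟨ τ +1⟩ ∷ [])) where

  T₀ T : List Word
  T₀ = 1213ₚ ∷ τ ∷ []
  T  = 1213ₚ ∷ 1⟨ τ +1⟩ ∷ []

  -- The words v+1, the words (v+1)1u, both kinds together, and all avoiders.
  cores mixed tails full : ℕ → List Word
  cores zero    = []
  cores (suc n) = map (map suc) (avoiders T₀ (suc n))
  mixed zero    = []
  mixed (suc n) = map (List._∷ʳ 1) (tails n) ++ map (List._∷ʳ 2) (mixed n)
  tails n = cores n ++ mixed n
  full zero    = [] ∷ []
  full (suc n) = map (1 ∷_) (full n ++ tails n)

  -- The invariant kept while letters are appended on the right. Avoidance is stated with the
  -- leading 1 in place, and `head≡2` later separates `tails` from `full`.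
  record Tail (n : ℕ) (w : Word) : Set where
    constructor tail
    field
      length≡ : length w ≡ n
      rgw     : RGW 1 w
      avoids  : AvoidsAll T (1 ∷ w)
      head≡2  : ∃ λ v → w ≡ 2 ∷ v

  Tail-∷ʳ : ∀ {n w c} → 1 ≤ c → c ≤ 2 → Tail n w → Tail (suc n) (w List.∷ʳ c)
  Tail-∷ʳ {w = w} 1≤c c≤2 (tail refl r av (v , refl)) = tail
    (trans (length-++ w) (ℕ.+-comm (length w) 1))
    (RGW-∷ʳ⁺ 1≤c c≤2 r)
    (All.zipWith (λ (t , ¬c) → ¬c ∘ Contains-∷ʳ⁻ t (s≤s z≤n ∷ RGW-positive r) 1≤c c≤2)
      (1213-ρ-tall , av))
    (_ , refl)

  ∈-cores⁻ : ∀ n {w} → w ∈ cores n → ∃ λ v → w ≡ map suc v × v ∈ avoiders T₀ n × 1 ≤ n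
  ∈-cores⁻ (suc n) w∈ with ∈-map⁻ (map suc) w∈
  ... | v , v∈ , refl = v , refl , v∈ , s≤s z≤n

  cores⇒Tail : ∀ n {w} → w ∈ cores n → Tail n w
  cores⇒Tail n w∈ with ∈-cores⁻ n w∈
  ... | v , refl , v∈ , 1≤n with ∈-avoiders⁻ T₀ n v∈
  ... | refl , r , ¬1213 ∷ ¬τ ∷ [] = tail
    (length-map ℕ.suc v)
    (RGW-suc⁺ r)
    (¬1213 ∘ Contains-1213-1⟨+1⟩⁻ (RGW-positive r) ∷ ¬τ ∘ Contains-1⟨+1⟩⁻ ∷ [])
    (starts r 1≤n)
    where
    starts : ∀ {v} → IsPartition v → 1 ≤ length v → ∃ λ u → map suc v ≡ 2 ∷ u
    starts ((s≤s z≤n , s≤s z≤n) ∷ _) _ = _ , refl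

  mixed⇒Tail : ∀ n {w} → w ∈ mixed n → Tail n w
  tails⇒Tail : ∀ n {w} → w ∈ tails n → Tail n w

  mixed⇒Tail (suc n) w∈ with ∈-++⁻ (map (List._∷ʳ 1) (tails n)) w∈
  ... | inj₁ w∈₁ with _ , v∈ , refl ← ∈-map⁻ (List._∷ʳ 1) w∈₁ =
    Tail-∷ʳ (s≤s z≤n) (s≤s z≤n) (tails⇒Tail n v∈)
  ... | inj₂ w∈₂ with _ , v∈ , refl ← ∈-map⁻ (List._∷ʳ 2) w∈₂ =
    Tail-∷ʳ (s≤s z≤n) (s≤s (s≤s z≤n)) (mixed⇒Tail n v∈)

  tails⇒Tail n w∈ with ∈-++⁻ (cores n) w∈
  ... | inj₁ w∈₁ = cores⇒Tail n w∈₁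
  ... | inj₂ w∈₂ = mixed⇒Tail n w∈₂

  ∈-full⁻ : ∀ n {w} → w ∈ full n → length w ≡ n × IsPartition w × AvoidsAll T w
  ∈-full⁻ zero (here refl) =
    -- The empty word embeds in the one-letter word, which is too short for either pattern.
    refl , [] , AvoidsAll-⊆ (1 ∷ʳ []) (All.map [1]-avoids 1213-ρ-tall)
  ∈-full⁻ (suc n) w∈ with ∈-map⁻ (1 ∷_) w∈
  ... | v , v∈ , refl with ∈-++⁻ (full n) v∈
  ... | inj₁ v∈₁ with ∈-full⁻ n v∈₁
  ...   | refl , [] , _ = refl , (s≤s z≤n , s≤s z≤n) ∷ [] , All.map [1]-avoids 1213-ρ-tall
  ...   | refl , (s≤s z≤n , s≤s z≤n) ∷ r , av =
    refl , (s≤s z≤n , s≤s z≤n) ∷ (s≤s z≤n , s≤s z≤n) ∷ r ,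
    All.zipWith (λ (t , ¬c) → ¬c ∘ Contains-11⁻ t) (1213-ρ-tall , av)
  ∈-full⁻ (suc n) w∈ | v , v∈ , refl | inj₂ v∈₂ with tails⇒Tail n v∈₂
  ... | tail refl r av _ = refl , (s≤s z≤n , s≤s z≤n) ∷ r , av

  -- An occurrence of 1213 survives raising, and one of τ becomes an occurrence of ρ once the
  -- leading 1 is added; so the word before raising avoids both 1213 and τ.
  ∈-cores⁺ : ∀ {a v} → All (1 ≤_) (a ∷ v) → RGW 1 (map suc (a ∷ v)) →
    AvoidsAll T 1⟨ a ∷ v +1⟩ → map suc (a ∷ v) ∈ cores (length (map ℕ.suc (a ∷ v)))
  ∈-cores⁺ {a} {v} 1≤v r (¬1213 ∷ ¬ρ ∷ []) rewrite length-map ℕ.suc v =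
    ∈-map⁺ (map suc) (∈-avoiders⁺ (RGW-suc⁻ 1≤v r)
      ( (λ c → ¬1213 (Contains-⊆ (1 ∷ʳ ⊆-refl) (Contains-map⁺ suc-mono c)))
      ∷ (λ c → ¬ρ (Contains-1⟨+1⟩⁺ 1≤v 1≤τ c)) ∷ []))

  -- Since `mixed` is generated by last letters, the letters of `u` move one at a time to the end of
  -- a growing `w`.
  mixed-++ : ∀ {w} u → All (1 ≤_) u → All (_≤ 2) u →
    w ∈ mixed (length w) → w ++ u ∈ mixed (length (w ++ u))
  mixed-++ {w} [] _ _ w∈ rewrite ++-identityʳ w = w∈
  mixed-++ {w} (c ∷ u) (1≤c ∷ 1≤u) (c≤2 ∷ u≤2) w∈ =
    subst (λ v → v ∈ mixed (length v)) (∷ʳ-++ w c u)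
      (mixed-++ u 1≤u u≤2 (subst (λ n → w List.∷ʳ c ∈ mixed n)
        (sym (trans (length-++ w) (ℕ.+-comm (length w) 1))) (snoc 1≤c c≤2)))
    where
    snoc : ∀ {c} → 1 ≤ c → c ≤ 2 → w List.∷ʳ c ∈ mixed (suc (length w))
    snoc (s≤s z≤n) (s≤s z≤n)       = ∈-++⁺ˡ (∈-map⁺ _ (∈-++⁺ʳ (cores (length w)) w∈))
    snoc (s≤s z≤n) (s≤s (s≤s z≤n)) =
      ∈-++⁺ʳ (map (List._∷ʳ 1) (tails (length w))) (∈-map⁺ _ w∈)

  -- Without a 1 the word is a core. Otherwise the part before the first 1 is a core, appending that
  -- 1 makes it mixed, and what follows has letters at most 2.
  ∈-tails⁺ : ∀ {w} → FirstOne w → (∃ λ v → w ≡ 2 ∷ v) → RGW 1 w → AvoidsAll T (1 ∷ w) →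
    w ∈ tails (length w)
  ∈-tails⁺ (absent (a ∷ v) 1≤v) _ r av = ∈-++⁺ˡ (∈-cores⁺ 1≤v r av)
  ∈-tails⁺ (present (a ∷ v) u 1≤v) (_ , refl) r av@(¬1213 ∷ _) =
    ∈-++⁺ʳ (cores (length (core ++ 1 ∷ u)))
      (subst (λ w → w ∈ mixed (length w)) (∷ʳ-++ core 1 u)
        (mixed-++ u 1≤u u≤2 (subst (λ n → core List.∷ʳ 1 ∈ mixed n)
          (sym (trans (length-++ core) (ℕ.+-comm (length core) 1)))
          (∈-++⁺ˡ (∈-map⁺ (List._∷ʳ 1) (∈-++⁺ˡ core∈))))))
    where
    core : Word
    core = map suc (a ∷ v)
    core∈ : core ∈ cores (length core)
    core∈ = ∈-cores⁺ 1≤v (RGW-++⁻ˡ core r)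
      (AvoidsAll-⊆ (refl ∷ Sublist.++⁺ʳ (1 ∷ u) ⊆-refl) av)
    1≤u : All (1 ≤_) u
    1≤u with _ ∷ 1≤u ← All.++⁻ʳ core (RGW-positive r) = 1≤u
    -- A letter c > 2 of `u` would complete 1 2 1 c: the prefixed 1, the head of the core, the 1 at
    -- the cut, and c.
    u≤2 : All (_≤ 2) u
    u≤2 = All.tabulate λ c∈u → ℕ.≮⇒≥ λ 2<c → ¬1213 (Contains-⊆
      (refl ∷ refl ∷ Sublist.++⁺ˡ (map suc v) (refl ∷ from∈ c∈u)) (121c-Contains-1213 2<c))
  ∈-tails⁺ (absent [] _)    (_ , ())
  ∈-tails⁺ (present [] _ _) (_ , ())

  -- After the initial 1, restricted growth allows only 1 or 2: a second 1 leads to the recursive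
  -- case, a 2 starts a tail.
  ∈-full⁺ : ∀ {w} → IsPartition w → AvoidsAll T w → w ∈ full (length w)
  ∈-full⁺ [] _ = here refl
  ∈-full⁺ ((s≤s z≤n , s≤s z≤n) ∷ []) _ = here refl
  ∈-full⁺ ((s≤s z≤n , s≤s z≤n) ∷ (s≤s z≤n , s≤s z≤n) ∷ r) av =
    ∈-map⁺ (1 ∷_) (∈-++⁺ˡ (∈-full⁺ ((s≤s z≤n , s≤s z≤n) ∷ r) (AvoidsAll-⊆ (1 ∷ʳ ⊆-refl) av)))
  ∈-full⁺ {1 ∷ w} ((s≤s z≤n , s≤s z≤n) ∷ r@((s≤s z≤n , s≤s (s≤s z≤n)) ∷ _)) av =
    ∈-map⁺ (1 ∷_) (∈-++⁺ʳ (full (length w))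
      (∈-tails⁺ (firstOne (RGW-positive r)) (_ , refl) r av))

  -- Absence of repetitions in the lists

  cores-unique : ∀ n → Unique (cores n)
  cores-unique zero    = []
  cores-unique (suc n) =
    Unique.map⁺ (map-injective ℕ.suc-injective) (avoiders-unique T₀ (suc n))

  -- The letter 1 tells `mixed` from `cores`; it persists because 2 is appended only to words that
  -- already contain a 1.
  1∈mixed : ∀ n {w} → w ∈ mixed n → 1 ∈ w
  1∈mixed (suc n) w∈ with ∈-++⁻ (map (List._∷ʳ 1) (tails n)) w∈
  ... | inj₁ w∈₁ with v , _ , refl ← ∈-map⁻ (List._∷ʳ 1) w∈₁ = ∈-++⁺ʳ v (here refl)
  ... | inj₂ w∈₂ with _ , v∈ , refl ← ∈-map⁻ (List._∷ʳ 2) w∈₂ = ∈-++⁺ˡ (1∈mixed n v∈)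

  1∉cores : ∀ n {w} → w ∈ cores n → ¬ 1 ∈ w
  1∉cores n w∈ 1∈ with ∈-cores⁻ n w∈
  ... | v , refl , v∈ , _ with ∈-avoiders⁻ T₀ n v∈
  ... | _ , r , _ = ℕ.<-irrefl refl (All.lookup (map-suc>1 (RGW-positive r)) 1∈)

  mixed-unique : ∀ n → Unique (mixed n)
  tails-unique : ∀ n → Unique (tails n)

  mixed-unique zero    = []
  mixed-unique (suc n) = Unique.++⁺
    (Unique.map⁺ (proj₁ ∘ ∷ʳ-injective _ _) (tails-unique n))
    (Unique.map⁺ (proj₁ ∘ ∷ʳ-injective _ _) (mixed-unique n))
    disjoint
    where
    disjoint : Disjoint (map (List._∷ʳ 1) (tails n)) (map (List._∷ʳ 2) (mixed n))
    disjoint (w∈₁ , w∈₂) with ∈-map⁻ (List._∷ʳ 1) w∈₁ | ∈-map⁻ (List._∷ʳ 2) w∈₂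
    ... | v , _ , refl | v′ , _ , eq = contradiction (proj₂ (∷ʳ-injective v v′ eq)) λ ()

  tails-unique n = Unique.++⁺ (cores-unique n) (mixed-unique n)
    λ (w∈cores , w∈mixed) → 1∉cores n w∈cores (1∈mixed n w∈mixed)

  full-unique : ∀ n → Unique (full n)
  full-unique zero    = [] ∷ []
  full-unique (suc n) = Unique.map⁺ ∷-injectiveʳ
    (Unique.++⁺ (full-unique n) (tails-unique n) disjoint)
    where
    disjoint : Disjoint (full n) (tails n)
    -- Words of `full n` are empty or begin with 1, those of `tails n` begin with 2.
    disjoint (w∈full , w∈tails) with ∈-full⁻ n w∈full | Tail.head≡2 (tails⇒Tail n w∈tails)
    ... | _ , (_ , s≤s ()) ∷ _ , _ | _ , refl

  p≡length-full : ∀ n → p T n ≡ length (full n)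
  p≡length-full n = unique∧set⇒length (avoiders-unique T n) (full-unique n)
    (mk⇔ to from)
    where
    to : ∀ {w} → w ∈ avoiders T n → w ∈ full n
    to w∈ with refl , r , av ← ∈-avoiders⁻ T n w∈ = ∈-full⁺ r av
    from : ∀ {w} → w ∈ full n → w ∈ avoiders T n
    from w∈ with refl , r , av ← ∈-full⁻ n w∈ = ∈-avoiders⁺ r av

  -- Recurrences for the counts

  length-cores : ∀ n → length (cores (suc n)) ≡ p T₀ (suc n)
  length-cores n = length-map (map suc) (avoiders T₀ (suc n))

  -- A core is extended by 1 only, a mixed word by 1 or 2. The double count of mixed words is the
  -- source of the factor 1-2x.
  length-mixed : ∀ n → length (mixed (suc n)) ≡
    (length (cores n) ℕ.+ length (mixed n)) ℕ.+ length (mixed n)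
  length-mixed n = trans (length-++ (map (List._∷ʳ 1) (tails n)))
    (cong₂ ℕ._+_ (trans (length-map _ (tails n)) (length-++ (cores n))) (length-map _ (mixed n)))

  length-full : ∀ n → length (full (suc n)) ≡
    length (full n) ℕ.+ (length (cores n) ℕ.+ length (mixed n))
  length-full n = trans (length-map (1 ∷_) (full n ++ tails n))
    (trans (length-++ (full n)) (cong (length (full n) ℕ.+_) (length-++ (cores n))))

-- Generating functions

last>2-map-suc : ∀ {m} → Maybe.Any (1 <_) m → Maybe.Any (2 <_) (mapMaybe suc m)
last>2-map-suc (just 1<a) = just (s≤s 1<a)

-- A nonempty partition starts with 1, so ρ starts with 1 2, and its last letter is one more than
-- that of τ.
1213-ρ-tall : ∀ {τ} → IsPartition τ → Maybe.Any (1 <_) (last τ) →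
  All Tall (1213ₚ ∷ 1⟨ τ +1⟩ ∷ [])
1213-ρ-tall {1 ∷ τ} ((s≤s z≤n , s≤s z≤n) ∷ _) last>1 =
  tall (just (s≤s (s≤s (s≤s z≤n)))) ∷
  tall (subst (Maybe.Any (2 <_)) (sym (last-map ℕ.suc (1 ∷ τ))) (last>2-map-suc last>1)) ∷ []

H-1⟨+1⟩ : ∀ τ → Admissible τ →
  H 1⟨ τ +1⟩ ≗
    const (+ 1)
    + x / (const (+ 1) - x) * H τ
    + x * x / ((const (+ 1) - x) * (const (+ 1) - const (+ 2) * x)) * (H τ - const (+ 1))
H-1⟨+1⟩ [] record { last>1 = () }
H-1⟨+1⟩ τ@(_ ∷ _) adm n = trans (cong +_ (p≡length-full n))
  (system-solution {x} {y} {recip (const 1ℤ - x)} {recip ((const 1ℤ - x) * (const 1ℤ - y))}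
    {f} {g} {m} {H τ}
    -- Both denominators have constant term 1 by computation.
    (*-recip (const 1ℤ - x) refl) (*-recip ((const 1ℤ - x) * (const 1ℤ - y)) refl)
    h≗ m≗ f≗ n)
  where
  open Admissible adm
  open Decomposition τ (RGW-positive isPartition) (1213-ρ-tall isPartition last>1)
  open LinearSystem seriesRing
  y f g m : Series
  y   = const (+ 2) * x
  f k = + length (full k)
  g k = + length (cores k)
  m k = + length (mixed k)
  h≗ : H τ ≗ g + const 1ℤ
  -- In degree 0, `cores` is empty, while `H τ` counts the empty word; this computes because τ is
  -- matched as a nonempty list.
  h≗ zero    = refl
  h≗ (suc k) = trans (cong +_ (sym (length-cores k))) (sym (ℤ.+-identityʳ (g (suc k))))
  m≗ : m ≗ x * g + y * m
  m≗ zero    = refl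
  m≗ (suc k) = begin
    m (suc k)
      ≡⟨ cong +_ (length-mixed k) ⟩
    (g k ℤ.+ m k) ℤ.+ m k
      ≡⟨ solve 2 (λ a b → (a :+ b) :+ b := a :+ con (+ 2) :* b) refl (g k) (m k) ⟩
    g k ℤ.+ + 2 ℤ.* m k
      ≡⟨ cong₂ (λ a b → a ℤ.+ + 2 ℤ.* b) (x-*-suc g k) (x-*-suc m k) ⟨
    (x * g) (suc k) ℤ.+ + 2 ℤ.* (x * m) (suc k)
      ≡⟨ cong₂ ℤ._+_ (refl {x = (x * g) (suc k)})
           (trans (*-assoc (const (+ 2)) x m (suc k)) (const-* (+ 2) (x * m) (suc k))) ⟨
    (x * g + y * m) (suc k) ∎
    where
    open ≡-Reasoning
    open +-*-Solver
  f≗ : f ≗ const 1ℤ + x * (g + m) + x * f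
  f≗ zero    = refl
  f≗ (suc k) = begin
    f (suc k)
      ≡⟨ cong +_ (length-full k) ⟩
    f k ℤ.+ (g k ℤ.+ m k)
      ≡⟨ solve 2 (λ a b → a :+ b := con 0ℤ :+ b :+ a) refl (f k) (g k ℤ.+ m k) ⟩
    0ℤ ℤ.+ (g k ℤ.+ m k) ℤ.+ f k
      ≡⟨ cong₂ (λ a b → 0ℤ ℤ.+ a ℤ.+ b) (x-*-suc (g + m) k) (x-*-suc f k) ⟨
    (const 1ℤ + x * (g + m) + x * f) (suc k) ∎
    where
    open ≡-Reasoning
    open +-*-Solver

-- The right-hand side of the formula depends on τ only through the coefficients of `H τ`. The
-- resulting equality in ℤ returns to ℕ by injectivity of `+_`.
p-1⟨+1⟩-cong : ∀ τ τ′ → Admissible τ → Admissible τ′ →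
  (∀ n → p (1213ₚ ∷ τ ∷ []) n ≡ p (1213ₚ ∷ τ′ ∷ []) n) →
  ∀ n → p (1213ₚ ∷ 1⟨ τ +1⟩ ∷ []) n ≡ p (1213ₚ ∷ 1⟨ τ′ +1⟩ ∷ []) n
p-1⟨+1⟩-cong τ τ′ adm adm′ p≗ n = ℤ.+-injective
  (trans (H-1⟨+1⟩ τ adm n) (trans formula-cong (sym (H-1⟨+1⟩ τ′ adm′ n))))
  where
  H≗ : H τ ≗ H τ′
  H≗ k = cong +_ (p≗ k)
  a b : Series
  a = x / (const 1ℤ - x)
  b = x * x / ((const 1ℤ - x) * (const 1ℤ - const (+ 2) * x))
  formula-cong : (const 1ℤ + a * H τ + b * (H τ - const 1ℤ)) n
               ≡ (const 1ℤ + a * H τ′ + b * (H τ′ - const 1ℤ)) n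
  formula-cong = cong₂ (λ i j → const 1ℤ n ℤ.+ i ℤ.+ j)
    (*-cong {a} (λ _ → refl) H≗ n)
    (*-cong {b} (λ _ → refl) (λ k → cong (ℤ._- const 1ℤ k) (H≗ k)) n)

theorem4p9 :
  (∀ τ → Admissible τ →
     H 1⟨ τ +1⟩ ≗
       const (+ 1)
       + x / (const (+ 1) - x) * H τ
       + x * x / ((const (+ 1) - x) * (const (+ 1) - const (+ 2) * x)) * (H τ - const (+ 1)))
  ×
  (∀ τ τ′ → Admissible τ → Admissible τ′ →
     (∀ n → p (1213ₚ ∷ τ ∷ []) n ≡ p (1213ₚ ∷ τ′ ∷ []) n) →
     ∀ n → p (1213ₚ ∷ 1⟨ τ +1⟩ ∷ []) n ≡ p (1213ₚ ∷ 1⟨ τ′ +1⟩ ∷ []) n)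
theorem4p9 = H-1⟨+1⟩ , p-1⟨+1⟩-cong
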